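{- Let $\mathcal{H}=(V,\mathcal{E})$ be a hypergraph. If $|V|\ge2$, $\bigcup\mathcal{E}=V$ and the automorphism group $Aut(\mathcal{H})$ is $2$-set transitive on $V$, then the Boolean function $f_{\mathcal{H}}$ is irreducible.
   Context: A hypergraph is a pair $\mathcal{H}=(V,\mathcal{E})$ with $V$ a finite nonempty set and $\mathcal{E}$ a set of subsets of $V$ (the empty set is allowed as a hyperedge). An automorphism of $\mathcal{H}$ is a bijection $\varphi:V\to V$ such that for all $E\subseteq V$, $E\in\mathcal{E}$ iff $\varphi(E)\in\mathcal{E}$; $Aut(\mathcal{H})$ is the group of automorphisms. A group $G$ acting on $V$ is $2$-set transitive if for all two-element subsets $e,e'$ of $V$ there is $g\in G$ with $g(e)=e'$. A Boolean function is a map $f:\{0,1\}^n\to\{0,1\}$, $n\ge1$; $\Omega$ is the set of all of them. For $g$ of arity $m$ and $f$ of arity $n$, $g\le f$ ($g$ is a simple minor of $f$) if there is $\sigma:\{1,\dots,n\}\to\{1,\dots,m\}$ with $g(x_1,\dots,x_m)=f(x_{\sigma(1)},\dots,x_{\sigma(n)})$; $g<f$ means $g\le f$ and not $f\le g$. $f$ is irreducible if there is $f'\in\Omega$ with $f'<f$ such that every $g\in\Omega$ with $g<f$ satisfies $g\le f'$. For a hypergraph $\mathcal{H}=(V,\mathcal{E})$ (with $V$ identified with $\{1,\dots,n\}$), $f_{\mathcal{H}}$ is the $n$-ary Boolean function given by evaluating over $GF(2)$ the polynomial $P_{\mathcal{H}}=\sum_{E\in\mathcal{E}}\prod_{i\in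 E}x_i$. -}

module Defs where

open import Level using (0ℓ)
open import Algebra.Bundles using (Group)
open import Data.Bool.Base using (Bool; false; _xor_)
open import Data.Bool.ListAction using (and)
open import Data.Fin.Base using (Fin)
open import Data.Fin.Permutation as Perm
  using (Permutation′; _⟨$⟩ʳ_; _∘ₚ_; inverseˡ; inverseʳ)
open import Data.Fin.Properties using (any?; _≟_)
open import Data.Fin.Subset using (Subset; _∈_; ∣_∣)
open import Data.Fin.Subset.Properties using (_∈?_; ⊆-antisym)
open import Data.List.Base using (List; foldr; map; filter; allFin)
import Data.List.Membership.Propositional as List
open import Data.List.Relation.Unary.Unique.Propositional using (Unique)
open import Data.Nat.Base using (ℕ; NonZero)
open import Data.Product.Base using (Σ; ∃; _×_; _,_)
open import Data.Vec.Base using (Vec; lookup; tabulate)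
open import Data.Vec.Properties using (lookup∘tabulate; []=⇒lookup; lookup⇒[]=)
open import Function.Base using (_∘_; id)
open import Function.Bundles using (_⇔_; mk⇔; module Equivalence)
open import Relation.Binary.PropositionalEquality
  using (_≡_; refl; sym; trans; cong; subst)
open import Relation.Nullary.Decidable
  using (Dec; does; yes; no; dec-true; _×-dec_)
open import Relation.Nullary.Negation using (¬_)

------------------------------------------------------------------------
-- Boolean functions and simple minors

record BooleanFunction : Set where
  field
    arity       : ℕ
    ⦃ nonZero ⦄ : NonZero arity
    eval        : Vec Bool arity → Bool

open BooleanFunction public

infix 4 _≤ₘ_ _<ₘ_

_≤ₘ_ : BooleanFunction → BooleanFunction → Set
g ≤ₘ f = ∃ λ (σ : Fin (arity f) → Fin (arity g)) →
  ∀ (x : Vec Bool (arity g)) → eval g x ≡ eval f (tabulate (lookup x ∘ σ))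

_<ₘ_ : BooleanFunction → BooleanFunction → Set
g <ₘ f = g ≤ₘ f × ¬ (f ≤ₘ g)

Irreducible : BooleanFunction → Set
Irreducible f = ∃ λ f′ → f′ <ₘ f × (∀ g → g <ₘ f → g ≤ₘ f′)

------------------------------------------------------------------------
-- Direct images of subsets

-- image φ E = { φ i ∣ i ∈ E }
image : ∀ {m n} → (Fin m → Fin n) → Subset m → Subset n
image φ E = tabulate λ j → does (any? λ i → (i ∈? E) ×-dec (φ i ≟ j))

module _ {m n} (φ : Fin m → Fin n) {E : Subset m} {j : Fin n} where

  private
    pre? : Dec (∃ λ i → i ∈ E × φ i ≡ j)
    pre? = any? λ i → (i ∈? E) ×-dec (φ i ≟ j)

    look : lookup (image φ E) j ≡ does pre?
    look = lookup∘tabulate _ j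

  ∈-image⁺ : (∃ λ i → i ∈ E × φ i ≡ j) → j ∈ image φ E
  ∈-image⁺ p = lookup⇒[]= j _ (trans look (dec-true pre? p))

  ∈-image⁻ : j ∈ image φ E → ∃ λ i → i ∈ E × φ i ≡ j
  ∈-image⁻ j∈ with pre? | trans (sym look) ([]=⇒lookup j∈)
  ... | yes p | _  = p
  ... | no _  | ()

image-cong : ∀ {m n} {φ ψ : Fin m → Fin n} → (∀ i → φ i ≡ ψ i) →
             ∀ E → image φ E ≡ image ψ E
image-cong {φ = φ} {ψ} eq E = ⊆-antisym
  (λ j∈ → let i , i∈ , e = ∈-image⁻ φ j∈ in ∈-image⁺ ψ (i , i∈ , trans (sym (eq i)) e))
  (λ j∈ → let i , i∈ , e = ∈-image⁻ ψ j∈ in ∈-image⁺ φ (i , i∈ , trans (eq i) e))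

image-id : ∀ {n} (E : Subset n) → image id E ≡ E
image-id E = ⊆-antisym
  (λ j∈ → let _ , i∈ , e = ∈-image⁻ id j∈ in subst (_∈ E) e i∈)
  (λ j∈ → ∈-image⁺ id (_ , j∈ , refl))

image-∘ : ∀ {l m n} (φ : Fin m → Fin n) (ψ : Fin l → Fin m) (E : Subset l) →
          image (φ ∘ ψ) E ≡ image φ (image ψ E)
image-∘ φ ψ E = ⊆-antisym
  (λ j∈ → let i , i∈ , e = ∈-image⁻ (φ ∘ ψ) j∈ in
     ∈-image⁺ φ (ψ i , ∈-image⁺ ψ (i , i∈ , refl) , e))
  (λ j∈ → let k , k∈ , e  = ∈-image⁻ φ j∈
              i , i∈ , e′ = ∈-image⁻ ψ k∈ in
     ∈-image⁺ (φ ∘ ψ) (i , i∈ , trans (cong φ e′) e))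

------------------------------------------------------------------------
-- Hypergraphs

-- The vertex set is Fin order.  A set of subsets of it is given by a list
-- without repetitions; everything below is independent of its order.
record Hypergraph : Set where
  field
    order        : ℕ
    ⦃ nonEmpty ⦄ : NonZero order
    edges        : List (Subset order)
    unique       : Unique edges

open Hypergraph public using (order; edges)

-- GF(2) is Bool, with _xor_ as addition and _∧_ as multiplication.

monomial : ∀ {n} → Subset n → Vec Bool n → Bool
monomial E x = and (map (lookup x) (filter (_∈? E) (allFin _)))

f⟦_⟧ : Hypergraph → BooleanFunction
f⟦ H ⟧ = record
  { arity   = order H
  ; nonZero = Hypergraph.nonEmpty H
  ; eval    = λ x → foldr _xor_ false (map (λ E → monomial E x) (edges H))
  }

------------------------------------------------------------------------
-- Group actions

record Action (G : Group 0ℓ 0ℓ) (X : Set) : Set where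
  open Group G using (Carrier; _≈_; _∙_; ε)
  infixr 6 _·_
  field
    _·_    : Carrier → X → X
    ·-cong : ∀ {g h} → g ≈ h → ∀ x → g · x ≡ h · x
    ·-ε    : ∀ x → ε · x ≡ x
    ·-∙    : ∀ g h x → (g ∙ h) · x ≡ g · h · x

TwoSetTransitive : ∀ {G n} → Action G (Fin n) → Set
TwoSetTransitive {G} {n} A =
  ∀ (e e′ : Subset n) → ∣ e ∣ ≡ 2 → ∣ e′ ∣ ≡ 2 →
  ∃ λ (g : Group.Carrier G) → image (Action._·_ A g) e ≡ e′

------------------------------------------------------------------------
-- The automorphism group and its action on the vertices

IsAutomorphism : (H : Hypergraph) → Permutation′ (order H) → Set
IsAutomorphism H φ =
  ∀ E → E List.∈ edges H ⇔ image (φ ⟨$⟩ʳ_) E List.∈ edges H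

module _ (H : Hypergraph) where

  private
    ∈E : Subset (order H) → Set
    ∈E E = E List.∈ edges H

    open Equivalence using (to; from)

  id-isAutomorphism : IsAutomorphism H Perm.id
  id-isAutomorphism E = mk⇔ (subst ∈E (sym (image-id E))) (subst ∈E (image-id E))

  -- π ∘ₚ ρ applies π first.
  ∘-isAutomorphism : ∀ {φ ψ} → IsAutomorphism H φ → IsAutomorphism H ψ →
                     IsAutomorphism H (ψ ∘ₚ φ)
  ∘-isAutomorphism {φ} {ψ} aφ aψ E = mk⇔
    (subst ∈E (sym eq) ∘ to (aφ _) ∘ to (aψ E))
    (from (aψ E) ∘ from (aφ _) ∘ subst ∈E eq)
    where eq = image-∘ (φ ⟨$⟩ʳ_) (ψ ⟨$⟩ʳ_) E

  flip-isAutomorphism : ∀ {φ} → IsAutomorphism H φ → IsAutomorphism H (Perm.flip φ)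
  flip-isAutomorphism {φ} aφ E = mk⇔
    (from (aφ _) ∘ subst ∈E (sym eq))
    (subst ∈E eq ∘ to (aφ _))
    where
    φ⁻¹ = Perm.flip φ
    eq : image (φ ⟨$⟩ʳ_) (image (φ⁻¹ ⟨$⟩ʳ_) E) ≡ E
    eq = trans (sym (image-∘ (φ ⟨$⟩ʳ_) (φ⁻¹ ⟨$⟩ʳ_) E))
               (trans (image-cong (λ _ → inverseʳ φ) E) (image-id E))

  Aut : Group 0ℓ 0ℓ
  Aut = record
    { Carrier = Σ (Permutation′ (order H)) (IsAutomorphism H)
    ; _≈_     = λ (φ , _) (ψ , _) → φ Perm.≈ ψ
    ; _∙_     = λ (φ , aφ) (ψ , aψ) → ψ ∘ₚ φ , ∘-isAutomorphism {φ} {ψ} aφ aψ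
    ; ε       = Perm.id , id-isAutomorphism
    ; _⁻¹     = λ (φ , aφ) → Perm.flip φ , flip-isAutomorphism {φ} aφ
    ; isGroup = record
      { isMonoid = record
        { isSemigroup = record
          { isMagma = record
            { isEquivalence = record
              { refl  = λ _ → refl
              ; sym   = λ p i → sym (p i)
              ; trans = λ p q i → trans (p i) (q i)
              }
            ; ∙-cong = λ {(φ , _)} {(φ′ , _)} {(ψ , _)} {(ψ′ , _)} p q i →
                trans (cong (φ ⟨$⟩ʳ_) (q i)) (p (ψ′ ⟨$⟩ʳ i))
            }
          ; assoc = λ _ _ _ _ → refl
          }
        ; identity = (λ _ _ → refl) , (λ _ _ → refl)
        }
      ; inverse = (λ (φ , _) _ → inverseˡ φ) , (λ (φ , _) _ → inverseʳ φ)
      ; ⁻¹-cong = λ {(φ , _)} {(ψ , _)} p i →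
          trans (cong (φ Perm.⟨$⟩ˡ_) (trans (sym (inverseʳ ψ)) (sym (p _))))
                (inverseˡ φ)
      }
    }

  Aut-action : Action Aut (Fin (order H))
  Aut-action = record
    { _·_    = λ (φ , _) → φ ⟨$⟩ʳ_
    ; ·-cong = λ p → p
    ; ·-ε    = λ _ → refl
    ; ·-∙    = λ _ _ _ → refl
    }

{-# OPTIONS --safe #-}

-- A proper minor of f must identify two distinct variables, since a minor along
-- an injection is equivalent to f.  If the symmetries of f act 2-set transitively
-- on the variables, then up to equivalence it does not matter which two variables
-- are identified, so all proper minors lie below a single f′.  If moreover f depends
-- on all its variables, then f′, having fewer variables, is not above f.
--
-- Automorphisms of H are symmetries of the polynomial P_H.  If f_H did not depend
-- on the variable k, then no E ∋ k would be an edge: by induction on E, when no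
-- proper subset of E containing k is an edge, the indicator vectors of E and E ∖ {k}
-- are distinguished by the monomial of E and by no other monomial of P_H.

module Submission where

open import Defs
open import Algebra.Bundles using (CommutativeRing)
open import Data.Bool.Base using (Bool; true; false; _xor_)
open import Data.Bool.Properties using (⇔→≡; T-≡; xor-∧-commutativeRing)
open import Data.Fin.Base using (Fin; zero; suc)
open import Data.Fin.Permutation
  using (Permutation′; _⟨$⟩ʳ_; _⟨$⟩ˡ_; inverseˡ; inverseʳ)
open import Data.Fin.Properties using (_≟_; any?; <⇒notInjective)
open import Data.Fin.Subset using (Subset; outside; _∈_; _⊆_; _⊂_; ⁅_⁆; _∪_; ∣_∣; ⋃; ⊤)
open import Data.Fin.Subset.Induction using (⊂-wellFounded)
open import Data.Fin.Subset.Properties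
  using (_∈?_; ∈⊤; ∉⊥; x∈p∪q⁻; x∈p∪q⁺; x∈⁅x⁆; x∈⁅y⁆⇒x≡y; ∣⁅x⁆∣≡1; ∪-identityˡ; ∪-identityʳ;
         ⊆-antisym)
open import Data.List.Base using (List; []; _∷_; foldr; map; allFin)
open import Data.List.Membership.Propositional using () renaming (_∈_ to _∈ˡ_)
open import Data.List.Membership.Propositional.Properties
  using (∈-allFin; ∈-filter⁺; ∈-map⁺; ∈-map⁻)
open import Data.List.Membership.Propositional.Properties.WithK using (unique∧set⇒bag)
open import Data.List.Properties using (map-∘; map-cong; map-cong-local)
open import Data.List.Relation.Binary.BagAndSetEquality using (∼bag⇒↭)
open import Data.List.Relation.Binary.Permutation.Propositional using (_↭_; ↭⇒↭ₛ)
import Data.List.Relation.Binary.Permutation.Propositional.Properties as ↭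
open import Data.List.Relation.Binary.Permutation.Setoid.Properties using (foldr-commMonoid)
import Data.List.Relation.Unary.All as All
open import Data.List.Relation.Unary.All.Properties using (all⁺; all⁻; all-filter)
open import Data.List.Relation.Unary.AllPairs using (_∷_)
open import Data.List.Relation.Unary.Any using (here; there)
open import Data.List.Relation.Unary.Unique.Propositional using (Unique)
import Data.List.Relation.Unary.Unique.Propositional.Properties as Unique
open import Data.Nat.Base using (ℕ; zero; suc; NonZero; _≤_; _<_; s≤s)
open import Data.Nat.Properties using (n<1+n)
open import Data.Product.Base using (∃; ∃₂; _×_; _,_; proj₁; proj₂)
open import Data.Sum.Base using (_⊎_; inj₁; inj₂)
import Data.Sum.Base as Sum
open import Data.Vec.Base using (Vec; lookup; tabulate; _[_]≔_)
open import Data.Vec.Properties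
  using (lookup∘tabulate; tabulate-cong; tabulate∘lookup; []=⇒lookup; lookup⇒[]=;
         lookup∘update; lookup∘update′)
open import Function.Base using (_∘_; id)
open import Function.Bundles using (mk⇔; module Equivalence)
open import Function.Definitions using (Injective)
open import Induction.WellFounded using (Acc; acc)
open import Relation.Binary.PropositionalEquality
  using (_≡_; _≢_; _≗_; refl; sym; trans; cong; subst; module ≡-Reasoning)
open import Relation.Nullary.Decidable using (yes; no; ¬?; _×-dec_; decidable-stable)
open import Relation.Nullary.Negation using (¬_; contradiction)

open Equivalence using (to; from)
open ≡-Reasoning

private
  variable
    l m n : ℕ
    A : Set

-- Substitution of variables

reindex : (Fin n → Fin m) → Vec A m → Vec A n
reindex σ x = tabulate (lookup x ∘ σ)

reindex-cong : {σ τ : Fin n → Fin m} → σ ≗ τ → (x : Vec A m) → reindex σ x ≡ reindex τ x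
reindex-cong eq x = tabulate-cong (cong (lookup x) ∘ eq)

reindex-∘ : (σ : Fin m → Fin l) (τ : Fin n → Fin m) (x : Vec A l) →
            reindex τ (reindex σ x) ≡ reindex (σ ∘ τ) x
reindex-∘ σ τ x = tabulate-cong (lookup∘tabulate (lookup x ∘ σ) ∘ τ)

injective⇒leftInverse : .{{NonZero n}} → (σ : Fin n → Fin m) → Injective _≡_ _≡_ σ →
                        ∃ λ (τ : Fin m → Fin n) → τ ∘ σ ≗ id
injective⇒leftInverse {n = suc _} σ inj = τ , τ∘σ
  where
  τ : Fin _ → Fin _
  τ k with any? (λ i → σ i ≟ k)
  ... | yes (i , _) = i
  -- Off the range of `σ` any value serves; `zero` exists because `n` is nonzero.
  ... | no  _       = zero

  τ∘σ : τ ∘ σ ≗ id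
  τ∘σ i with any? (λ i′ → σ i′ ≟ σ i)
  ... | yes (_ , eq) = inj eq
  ... | no  ∄        = contradiction (i , refl) ∄

-- Essential variables, symmetries and a criterion for irreducibility

-- Comparing with the value `false` suffices: of two points that differ only at `k`, one arises from
-- the other by setting `k` to `false`.
DependsOn : (Vec Bool n → Bool) → Fin n → Set
DependsOn f k = ¬ (∀ x → f x ≡ f (x [ k ]≔ false))

IsSymmetry : (Vec Bool n → Bool) → (Fin n → Fin n) → Set
IsSymmetry f α = ∀ x → f (reindex α x) ≡ f x

-- Otherwise `σ` is injective, and substituting along a left inverse of it in `g` recovers `f`.
≤ₘ∧≱ₘ⇒collision : ∀ {f g} → ((σ , _) : g ≤ₘ f) → ¬ (f ≤ₘ g) →
                   ∃₂ λ i j → i ≢ j × σ i ≡ σ j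
≤ₘ∧≱ₘ⇒collision {f} {g} (σ , g≡fσ) f≰g
  with any? (λ i → any? (λ j → ¬? (i ≟ j) ×-dec (σ i ≟ σ j)))
... | yes (i , j , p) = i , j , p
... | no ∄ = contradiction (τ , f≡gτ) f≰g
  where
  σ-injective : Injective _≡_ _≡_ σ
  σ-injective {i} {j} eq = decidable-stable (i ≟ j) λ i≢j → ∄ (i , j , i≢j , eq)

  left : ∃ λ τ → τ ∘ σ ≗ id
  left = injective⇒leftInverse σ σ-injective

  τ = proj₁ left

  f≡gτ : ∀ x → eval f x ≡ eval g (reindex τ x)
  f≡gτ x = begin
    eval f x                         ≡⟨ cong (eval f) (tabulate∘lookup x) ⟨
    eval f (reindex id x)            ≡⟨ cong (eval f) (reindex-cong (proj₂ left) x) ⟨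
    eval f (reindex (τ ∘ σ) x)       ≡⟨ cong (eval f) (reindex-∘ τ σ x) ⟨
    eval f (reindex σ (reindex τ x)) ≡⟨ g≡fσ (reindex τ x) ⟨
    eval g (reindex τ x)             ∎

-- A variable of `f` outside the range of `τ` would be ignored by `f`. So `τ` is surjective, and a
-- section of it injects the variables of `f` into those of `g`.
dependsOnAll⇒arity-minimal : ∀ {f g} → (∀ k → DependsOn (eval f) k) → f ≤ₘ g →
                             ¬ (arity g < arity f)
dependsOnAll⇒arity-minimal {f} {g} dep (τ , f≡gτ) g<f =
  <⇒notInjective g<f section-injective
  where
  τ-surjective : ∀ k → ∃ λ i → τ i ≡ k
  τ-surjective k with any? (λ i → τ i ≟ k)
  ... | yes p = p
  ... | no ∄  = contradiction f-ignores-k (dep k)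
    where
    f-ignores-k : ∀ x → eval f x ≡ eval f (x [ k ]≔ false)
    f-ignores-k x = begin
      eval f x                                ≡⟨ f≡gτ x ⟩
      eval g (reindex τ x)                    ≡⟨ cong (eval g) (tabulate-cong λ i →
                                                   lookup∘update′ (λ eq → ∄ (i , eq)) x false) ⟨
      eval g (reindex τ (x [ k ]≔ false))     ≡⟨ f≡gτ (x [ k ]≔ false) ⟨
      eval f (x [ k ]≔ false)                 ∎

  section-injective : Injective _≡_ _≡_ (proj₁ ∘ τ-surjective)
  section-injective {k} {k′} eq =
    trans (sym (proj₂ (τ-surjective k))) (trans (cong τ eq) (proj₂ (τ-surjective k′)))

irreducible : (f : BooleanFunction) → 2 ≤ arity f →
  (∀ k → DependsOn (eval f) k) →
  (∀ {i j k l} → i ≢ j → k ≢ l → ∃ λ α → IsSymmetry (eval f) α ×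
     (α i ≡ k ⊎ α i ≡ l) × (α j ≡ k ⊎ α j ≡ l)) →
  Irreducible f
irreducible F@record { arity = suc (suc n) ; eval = f } (s≤s (s≤s _)) dep sym2 =
  F′ , ((π , λ _ → refl) , λ F≤F′ → dependsOnAll⇒arity-minimal {F} {F′} dep F≤F′ (n<1+n _)) , below
  where
  -- Merges the first two variables; `suc` is a section.
  π : Fin (suc (suc n)) → Fin (suc n)
  π zero    = zero
  π (suc i) = i

  F′ : BooleanFunction
  F′ = record { arity = suc n ; eval = f ∘ reindex π }

  below : ∀ g → g <ₘ F → g ≤ₘ F′
  below g ((σ , g≡fσ) , F≰g)
    with i , j , i≢j , σi≡σj ← ≤ₘ∧≱ₘ⇒collision {F} {g} (σ , g≡fσ) F≰g
    with α , symα , α0 , α1 ← sym2 {zero} {suc zero} (λ ()) i≢j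
    -- Since `π ∘ suc` is the identity, this is the only map through which `σ ∘ α` can factor over
    -- `π`.
    = σ ∘ α ∘ suc , λ x → begin
        eval g x                                   ≡⟨ g≡fσ x ⟩
        f (reindex σ x)                            ≡⟨ symα (reindex σ x) ⟨
        f (reindex α (reindex σ x))                ≡⟨ cong f (reindex-∘ σ α x) ⟩
        f (reindex (σ ∘ α) x)                      ≡⟨ cong f (reindex-cong factor x) ⟩
        f (reindex (σ ∘ α ∘ suc ∘ π) x)            ≡⟨ cong f (reindex-∘ (σ ∘ α ∘ suc) π x) ⟨
        f (reindex π (reindex (σ ∘ α ∘ suc) x))    ∎
    where
    σ≡σi : ∀ {k} → k ≡ i ⊎ k ≡ j → σ k ≡ σ i
    σ≡σi (inj₁ k≡i) = cong σ k≡i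
    σ≡σi (inj₂ k≡j) = trans (cong σ k≡j) (sym σi≡σj)

    factor : σ ∘ α ≗ σ ∘ α ∘ suc ∘ π
    -- The only index moved by `suc ∘ π` is `zero`, which goes to `suc zero`. Both are sent by `α`
    -- into the pair `i`, `j`, on which `σ` is constant.
    factor zero    = trans (σ≡σi α0) (sym (σ≡σi α1))
    factor (suc _) = refl

-- Monomials as containment tests

module _ {n} {E : Subset n} {x : Vec Bool n} where

  -- A `Subset n` is a vector of Booleans, so a point `x` is also the set of its true coordinates.
  monomial-true⁺ : E ⊆ x → monomial E x ≡ true
  monomial-true⁺ E⊆x = to T-≡ (all⁻ (lookup x)
    (All.map (from T-≡ ∘ []=⇒lookup ∘ E⊆x) (all-filter (_∈? E) (allFin n))))

  monomial-true⁻ : monomial E x ≡ true → E ⊆ x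
  monomial-true⁻ eq {i} i∈E = lookup⇒[]= i x (to T-≡
    (All.lookup (all⁺ (lookup x) _ (from T-≡ eq)) (∈-filter⁺ (_∈? E) (∈-allFin i) i∈E)))

monomial-cong : {E : Subset m} {F : Subset n} {x : Vec Bool m} {y : Vec Bool n} →
                (E ⊆ x → F ⊆ y) → (F ⊆ y → E ⊆ x) → monomial E x ≡ monomial F y
monomial-cong E⇒F F⇒E = ⇔→≡ (mk⇔
  (λ eq → monomial-true⁺ (E⇒F (monomial-true⁻ eq)))
  (λ eq → monomial-true⁺ (F⇒E (monomial-true⁻ eq))))

-- Reindexing along `φ` turns the set encoded by `x` into its preimage, and `E` lies in the preimage
-- exactly when its image lies in `x`.
monomial-reindex : (φ : Fin m → Fin n) (E : Subset m) (x : Vec Bool n) →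
                   monomial E (reindex φ x) ≡ monomial (image φ E) x
monomial-reindex φ E x = monomial-cong {E = E} {x = reindex φ x}
  (λ E⊆xφ j∈ → let i , i∈E , φi≡j = ∈-image⁻ φ j∈ in
    subst (_∈ x) φi≡j (lookup⇒[]= (φ i) x
      (trans (sym (lookup∘tabulate _ i)) ([]=⇒lookup (E⊆xφ i∈E)))))
  (λ φE⊆x {i} i∈E → lookup⇒[]= i _
    (trans (lookup∘tabulate _ i) ([]=⇒lookup (φE⊆x (∈-image⁺ φ (i , i∈E , refl))))))

-- Sums over GF(2)

private
  module GF2 = CommutativeRing xor-∧-commutativeRing
open import Algebra.Properties.Group GF2.+-group using (∙-cancelˡ; ∙-cancelʳ)

⨁ : List Bool → Bool
⨁ = foldr _xor_ false

⨁-↭ : ∀ {bs cs} → bs ↭ cs → ⨁ bs ≡ ⨁ cs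
⨁-↭ p = foldr-commMonoid GF2.setoid GF2.+-isCommutativeMonoid (↭⇒↭ₛ p)

-- The equal summands cancel, leaving `u a` against `v a`. Without repetitions `a` contributes only
-- once, so its difference cannot cancel itself.
⨁-differs-once : ∀ {u v : A → Bool} {as a} → Unique as → a ∈ˡ as → u a ≢ v a →
                 (∀ {b} → b ∈ˡ as → b ≢ a → u b ≡ v b) →
                 ⨁ (map u as) ≢ ⨁ (map v as)
⨁-differs-once {u = u} {v} {a ∷ as} (a∉as ∷ _) (here refl) ua≢va agree
  rewrite map-cong-local {f = u} {v} {as} (All.tabulate λ b∈ →
    agree (there b∈) λ b≡a → All.lookup a∉as b∈ (sym b≡a))
  = ua≢va ∘ ∙-cancelʳ _ _ _
⨁-differs-once {u = u} {v} {b ∷ as} (b∉as ∷ uniq) (there a∈as) ua≢va agree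
  rewrite agree (here refl) (All.lookup b∉as a∈as)
  = ⨁-differs-once uniq a∈as ua≢va (agree ∘ there) ∘ ∙-cancelˡ (v b) _ _

-- Covered vertices are essential variables

∈-⋃⁻ : ∀ (Es : List (Subset n)) {k} → k ∈ ⋃ Es → ∃ λ E → E ∈ˡ Es × k ∈ E
∈-⋃⁻ []       k∈ = contradiction k∈ ∉⊥
∈-⋃⁻ (E ∷ Es) k∈ with x∈p∪q⁻ E (⋃ Es) k∈
... | inj₁ k∈E = E , here refl , k∈E
... | inj₂ k∈⋃ = let F , F∈ , k∈F = ∈-⋃⁻ Es k∈⋃ in F , there F∈ , k∈F

module _ (E : Subset n) (k : Fin n) where

  ∉-delete : ¬ (k ∈ E [ k ]≔ outside)
  ∉-delete k∈ with () ← trans (sym (lookup∘update k E outside)) ([]=⇒lookup k∈)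

  ∈-delete⁺ : ∀ {i} → i ≢ k → i ∈ E → i ∈ E [ k ]≔ outside
  ∈-delete⁺ i≢k i∈E = lookup⇒[]= _ _ (trans (lookup∘update′ i≢k E outside) ([]=⇒lookup i∈E))

  delete⊆ : E [ k ]≔ outside ⊆ E
  delete⊆ {i} i∈ with i ≟ k
  ... | yes refl = contradiction i∈ ∉-delete
  ... | no  i≢k  = lookup⇒[]= _ _ (trans (sym (lookup∘update′ i≢k E outside)) ([]=⇒lookup i∈))

≢∧⊆⇒⊂ : {p q : Subset n} → p ≢ q → p ⊆ q → p ⊂ q
≢∧⊆⇒⊂ {p = p} {q} p≢q p⊆q with any? (λ i → (i ∈? q) ×-dec ¬? (i ∈? p))
... | yes (i , p) = p⊆q , i , p
... | no ∄ = contradiction (⊆-antisym p⊆q λ {i} i∈q →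
    decidable-stable (i ∈? p) λ i∉p → ∄ (i , i∈q , i∉p)) p≢q

module _ (H : Hypergraph) where

  independent⇒no-edge : ∀ {k} → (∀ x → eval f⟦ H ⟧ x ≡ eval f⟦ H ⟧ (x [ k ]≔ false)) →
                        ∀ {E} → Acc _⊂_ E → k ∈ E → ¬ (E ∈ˡ edges H)
  independent⇒no-edge {k} ind {E} (acc rec) k∈E E∈H =
    ⨁-differs-once (Hypergraph.unique H) E∈H distinguished agree (ind E)
    where
    E∖k : Subset (order H)
    E∖k = E [ k ]≔ outside

    distinguished : monomial E E ≢ monomial E E∖k
    distinguished eq = ∉-delete E k
      (monomial-true⁻ (trans (sym eq) (monomial-true⁺ {E = E} id)) k∈E)

    agree : ∀ {F} → F ∈ˡ edges H → F ≢ E → monomial F E ≡ monomial F E∖k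
    agree {F} F∈H F≢E = monomial-cong {E = F}
      -- By induction an edge `F` properly inside `E` avoids `k`, so it survives the deletion of
      -- `k`.
      (λ F⊆E {i} i∈F → ∈-delete⁺ E k
        (λ { refl → independent⇒no-edge ind (rec (≢∧⊆⇒⊂ F≢E F⊆E)) i∈F F∈H }) (F⊆E i∈F))
      (λ F⊆E∖k i∈F → delete⊆ E k (F⊆E∖k i∈F))

  covered⇒dependsOn : ∀ {k} → k ∈ ⋃ (edges H) → DependsOn (eval f⟦ H ⟧) k
  covered⇒dependsOn k∈⋃ ind = let E , E∈H , k∈E = ∈-⋃⁻ (edges H) k∈⋃ in
    independent⇒no-edge ind (⊂-wellFounded E) k∈E E∈H

-- Automorphisms act as symmetries of the polynomial

image-permutation-injective : (φ : Permutation′ n) → Injective _≡_ _≡_ (image (φ ⟨$⟩ʳ_))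
image-permutation-injective φ {E} {F} eq = begin
  E                                      ≡⟨ cancel E ⟨
  image (φ ⟨$⟩ˡ_) (image (φ ⟨$⟩ʳ_) E)    ≡⟨ cong (image (φ ⟨$⟩ˡ_)) eq ⟩
  image (φ ⟨$⟩ˡ_) (image (φ ⟨$⟩ʳ_) F)    ≡⟨ cancel F ⟩
  F                                      ∎
  where
  cancel : ∀ D → image (φ ⟨$⟩ˡ_) (image (φ ⟨$⟩ʳ_) D) ≡ D
  cancel D = trans (sym (image-∘ (φ ⟨$⟩ˡ_) (φ ⟨$⟩ʳ_) D))
    (trans (image-cong (λ _ → inverseˡ φ) D) (image-id D))

module _ (H : Hypergraph) (φ : Permutation′ (order H)) (aut : IsAutomorphism H φ) where

  private
    φ[_] : Subset (order H) → Subset (order H)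
    φ[_] = image (φ ⟨$⟩ʳ_)

  -- Both lists are free of repetitions and have the same members, hence agree as bags.
  map-image-edges : map φ[_] (edges H) ↭ edges H
  map-image-edges = ∼bag⇒↭ (unique∧set⇒bag
    (Unique.map⁺ (image-permutation-injective φ) (Hypergraph.unique H))
    (Hypergraph.unique H)
    (mk⇔ image∈ ∈image))
    where
    image∈ : ∀ {E} → E ∈ˡ map φ[_] (edges H) → E ∈ˡ edges H
    image∈ E∈ with D , D∈H , refl ← ∈-map⁻ φ[_] E∈ = to (aut D) D∈H

    φφ⁻¹ : ∀ E → φ[ image (φ ⟨$⟩ˡ_) E ] ≡ E
    φφ⁻¹ E = trans (sym (image-∘ (φ ⟨$⟩ʳ_) (φ ⟨$⟩ˡ_) E))
      (trans (image-cong (λ _ → inverseʳ φ) E) (image-id E))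

    ∈image : ∀ {E} → E ∈ˡ edges H → E ∈ˡ map φ[_] (edges H)
    -- The backward half of `aut` makes the preimage of an edge an edge.
    ∈image {E} E∈H = subst (_∈ˡ map φ[_] (edges H)) (φφ⁻¹ E)
      (∈-map⁺ φ[_] (from (aut _) (subst (_∈ˡ edges H) (sym (φφ⁻¹ E)) E∈H)))

  -- Reindexing replaces each edge's monomial by that of its image, which only permutes the
  -- summands.
  automorphism⇒symmetry : IsSymmetry (eval f⟦ H ⟧) (φ ⟨$⟩ʳ_)
  automorphism⇒symmetry x = begin
    ⨁ (map (λ E → monomial E (reindex (φ ⟨$⟩ʳ_) x)) (edges H))
      ≡⟨ cong ⨁ (map-cong (λ E → monomial-reindex (φ ⟨$⟩ʳ_) E x) (edges H)) ⟩
    ⨁ (map (λ E → monomial φ[ E ] x) (edges H))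
      ≡⟨ cong ⨁ (map-∘ (edges H)) ⟩
    ⨁ (map (λ E → monomial E x) (map φ[_] (edges H)))
      ≡⟨ ⨁-↭ (↭.map⁺ _ map-image-edges) ⟩
    ⨁ (map (λ E → monomial E x) (edges H)) ∎

-- Two-element subsets and the conclusion

∣⁅i⁆∪⁅j⁆∣≡2 : {i j : Fin n} → i ≢ j → ∣ ⁅ i ⁆ ∪ ⁅ j ⁆ ∣ ≡ 2
∣⁅i⁆∪⁅j⁆∣≡2 {i = zero}  {zero}  i≢j = contradiction refl i≢j
∣⁅i⁆∪⁅j⁆∣≡2 {i = zero}  {suc j} _   =
  cong suc (trans (cong ∣_∣ (∪-identityˡ ⁅ j ⁆)) (∣⁅x⁆∣≡1 j))
∣⁅i⁆∪⁅j⁆∣≡2 {i = suc i} {zero}  _   =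
  cong suc (trans (cong ∣_∣ (∪-identityʳ ⁅ i ⁆)) (∣⁅x⁆∣≡1 i))
∣⁅i⁆∪⁅j⁆∣≡2 {i = suc i} {suc j} i≢j = ∣⁅i⁆∪⁅j⁆∣≡2 (i≢j ∘ cong suc)

-- Equality of sets does not tell which element goes where, hence the disjunctions in the symmetry
-- hypothesis of `irreducible`.
image-pair⁻ : (φ : Fin m → Fin n) (e : Subset m) {i : Fin m} {k l : Fin n} →
              image φ e ≡ ⁅ k ⁆ ∪ ⁅ l ⁆ → i ∈ e → φ i ≡ k ⊎ φ i ≡ l
image-pair⁻ φ e {i} {k} {l} eq i∈e = Sum.map (x∈⁅y⁆⇒x≡y k) (x∈⁅y⁆⇒x≡y l)
  (x∈p∪q⁻ ⁅ k ⁆ ⁅ l ⁆ (subst (φ i ∈_) eq (∈-image⁺ φ (i , i∈e , refl))))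

corollary13 : (H : Hypergraph) →
    2 ≤ order H →
    ⋃ (edges H) ≡ ⊤ →
    TwoSetTransitive (Aut-action H) →
    Irreducible f⟦ H ⟧
corollary13 H 2≤n ⋃≡⊤ transitive = irreducible f⟦ H ⟧ 2≤n
  (λ k → covered⇒dependsOn H (subst (k ∈_) (sym ⋃≡⊤) ∈⊤))
  λ {i} {j} {k} {l} i≢j k≢l →
    let (φ , aut) , φ[ij]≡kl = transitive (⁅ i ⁆ ∪ ⁅ j ⁆) (⁅ k ⁆ ∪ ⁅ l ⁆)
                                 (∣⁅i⁆∪⁅j⁆∣≡2 i≢j) (∣⁅i⁆∪⁅j⁆∣≡2 k≢l)
    in (φ ⟨$⟩ʳ_) , automorphism⇒symmetry H φ aut ,
       image-pair⁻ (φ ⟨$⟩ʳ_) _ φ[ij]≡kl (x∈p∪q⁺ (inj₁ (x∈⁅x⁆ i))) ,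
       image-pair⁻ (φ ⟨$⟩ʳ_) _ φ[ij]≡kl (x∈p∪q⁺ (inj₂ (x∈⁅x⁆ j)))
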